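{- Let $k,\ell,n$ be positive integers with $3k\ge \ell$. Then $$g(n,k,\ell)\ \geq\ \max_{k\ge j\ge \frac{\ell}{3}}\left\{\sum_{i=j}^{k}\binom{f(j,\ell)}{i}\binom{n-f(j,\ell)}{k-i}\right\},$$ where the maximum is over integers $j$ and $$f(j,\ell)=\begin{cases}2j-\lceil \frac{\ell}{3}\rceil & \text{if } \frac{\ell}{3}\le j<\frac{2\ell}{3},\\ 3j-\ell & \text{if } \frac{2\ell}{3}\le j.\end{cases}$$
   Context: Let $[n]=\{1,\dots,n\}$ and let $\binom{[n]}{k}$ be the family of all $k$-element subsets of $[n]$. For sets $A,B,C\subset[n]$ put $d(A,B,C)=|A\cap B|+|B\cap C|+|C\cap A|$. For a positive integer $\ell$, let $\mathbf{H}_\ell$ be the class of families $\mathcal{H}$ of subsets of $[n]$ such that $d(A,B,C)\ge \ell$ for all $A,B,C\in\mathcal{H}$ (no distinctness of $A,B,C$ is required in this definition). Define $g(n,k,\ell)=\max\{|\mathcal{F}| : \mathcal{F}\subset\binom{[n]}{k},\ \mathcal{F}\in\mathbf{H}_\ell\}$. Convention: if $a<b$ (including negative $a$), then $\binom{a}{b}$ is interpreted as $0$. -}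

module Defs where

open import Data.Bool.Properties using () renaming (_≟_ to _≟ᵇ_)
open import Data.Empty using (⊥)
open import Data.Fin.Subset using (Subset; inside; outside; _∩_; ∣_∣)
open import Data.Integer.Base using (ℤ; +_; -[1+_]; _⊖_; _-_)
open import Data.List.Base using (List; []; _∷_; _++_; map; filter; length; upTo)
open import Data.List.Extrema.Nat using (max; argmax-sel; xs≤max)
open import Data.List.Membership.Propositional using (_∈_)
open import Data.List.Membership.Propositional.Properties
open import Data.List.Properties using (length-++)
open import Data.List.Relation.Unary.All as All using (All; []; _∷_)
open import Data.List.Relation.Unary.AllPairs using ([]; _∷_)
open import Data.List.Relation.Unary.Any using (here; there; any?)
open import Data.List.Relation.Unary.Unique.Propositional using (Unique)
import Data.List.Relation.Unary.Unique.Propositional.Properties as Unique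
open import Data.Nat.Base using (ℕ; zero; suc; _+_; _*_; _∸_; _≤_; z≤n; s≤s)
open import Data.Nat.Combinatorics using (_C_)
open import Data.Nat.DivMod using (_/_)
open import Data.Nat.ListAction using (sum)
open import Data.Nat.Properties using (_≟_; _≤?_; _<?_; ≤-trans; ≤-reflexive; +-suc)
open import Data.Product.Base using (_×_; _,_; ∃; proj₁; proj₂)
open import Data.Sum.Base using (inj₁; inj₂)
open import Data.Vec.Base using ([]; _∷_)
open import Data.Vec.Properties using (≡-dec; ∷-injectiveʳ)
open import Function.Base using (id; _∘_)
open import Relation.Binary.Definitions using (DecidableEquality)
open import Relation.Binary.PropositionalEquality using (_≡_; refl; sym; trans; cong)
open import Relation.Nullary using (Dec; yes; no; contradiction)
open import Relation.Nullary.Decidable using (map′)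

-- The ground set [n] is Fin n. A family of subsets of [n] is a list without
-- repetitions (Unique is imposed wherever families are quantified over), so
-- that its cardinality is its length.
Family : ℕ → Set
Family n = List (Subset n)

d : ∀ {n} → Subset n → Subset n → Subset n → ℕ
d A B C = ∣ A ∩ B ∣ + ∣ B ∩ C ∣ + ∣ C ∩ A ∣

H : ∀ {n} → ℕ → Family n → Set
H ℓ F = ∀ {A B C} → A ∈ F → B ∈ F → C ∈ F → ℓ ≤ d A B C

H? : ∀ {n} ℓ (F : Family n) → Dec (H ℓ F)
H? ℓ F = map′
  (λ h A∈F B∈F C∈F → All.lookup (All.lookup (All.lookup h A∈F) B∈F) C∈F)
  (λ h → All.tabulate λ A∈F → All.tabulate λ B∈F → All.tabulate λ C∈F → h A∈F B∈F C∈F)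
  (All.all? (λ A → All.all? (λ B → All.all? (λ C → ℓ ≤? d A B C) F) F) F)

subsets : ∀ n → List (Subset n)
subsets zero    = [] ∷ []
subsets (suc n) = map (outside ∷_) (subsets n) ++ map (inside ∷_) (subsets n)

kSubsets : ∀ n → ℕ → Family n
kSubsets n k = filter (λ A → ∣ A ∣ ≟ k) (subsets n)

sublists : ∀ {A : Set} → List A → List (List A)
sublists []       = [] ∷ []
sublists (x ∷ xs) = sublists xs ++ map (x ∷_) (sublists xs)

-- Each F ⊆ ([n] choose k) occurs exactly once among the sublists of kSubsets n k;
-- g-isMaximum below shows that g is the intended maximum.
g : ℕ → ℕ → ℕ → ℕ
g n k ℓ = max 0 (map length (filter (H? ℓ) (sublists (kSubsets n k))))

-- The binomial coefficient with the convention that it is 0 whenever a < b,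
-- in particular for negative a (_C_ already returns 0 for 0 ≤ a < b).
binom : ℤ → ℕ → ℕ
binom (+ a)    b = a C b
binom -[1+ _ ] b = 0

⌈_/3⌉ : ℕ → ℕ
⌈ m /3⌉ = (m + 2) / 3

-- The case condition j < 2ℓ/3 is cleared of denominators. The differences are
-- integers, so nothing is truncated.
f : ℕ → ℕ → ℤ
f j ℓ with 3 * j <? 2 * ℓ
... | yes _ = (2 * j) ⊖ ⌈ ℓ /3⌉
... | no  _ = (3 * j) ⊖ ℓ

-- ∑_{i=j}^{k} term i
∑[_⋯_] : ℕ → ℕ → (ℕ → ℕ) → ℕ
∑[ j ⋯ k ] term = sum (map term (filter (j ≤?_) (upTo (suc k))))

lowerSum : ℕ → ℕ → ℕ → ℕ → ℕ
lowerSum n k ℓ j =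
  ∑[ j ⋯ k ] (λ i → binom (f j ℓ) i * binom (+ n - f j ℓ) (k ∸ i))

-- The integers j with ℓ/3 ≤ j ≤ k.
range : ℕ → ℕ → List ℕ
range k ℓ = filter (λ j → ℓ ≤? 3 * j) (upTo (suc k))

-- range k ℓ is nonempty when ℓ ≤ 3k, so the default value 0 is harmless.
maxLowerSum : ℕ → ℕ → ℕ → ℕ
maxLowerSum n k ℓ = max 0 (map (lowerSum n k ℓ) (range k ℓ))

IsMaximum : (ℕ → Set) → ℕ → Set
IsMaximum P m = P m × (∀ {x} → P x → x ≤ m)

AttainedSize : ℕ → ℕ → ℕ → ℕ → Set
AttainedSize n k ℓ m =
  ∃ λ (F : Family n) → Unique F × All (λ A → ∣ A ∣ ≡ k) F × H ℓ F × length F ≡ m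

private
  _≟ˢ_ : ∀ {n} → DecidableEquality (Subset n)
  _≟ˢ_ = ≡-dec _≟ᵇ_

  ∈-subsets : ∀ {n} (A : Subset n) → A ∈ subsets n
  ∈-subsets []            = here refl
  ∈-subsets (outside ∷ A) = ∈-++⁺ˡ (∈-map⁺ (outside ∷_) (∈-subsets A))
  ∈-subsets (inside ∷ A)  = ∈-++⁺ʳ _ (∈-map⁺ (inside ∷_) (∈-subsets A))

  subsets-unique : ∀ n → Unique (subsets n)
  subsets-unique zero    = [] ∷ []
  subsets-unique (suc n) = Unique.++⁺
    (Unique.map⁺ ∷-injectiveʳ (subsets-unique n))
    (Unique.map⁺ ∷-injectiveʳ (subsets-unique n))
    λ (p , q) → disjoint (∈-map⁻ (outside ∷_) p) (∈-map⁻ (inside ∷_) q)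
    where
    disjoint : ∀ {v : Subset (suc n)} {P Q : Subset n → Set} →
               ∃ (λ x → P x × v ≡ outside ∷ x) → ∃ (λ x → Q x × v ≡ inside ∷ x) →
               ⊥
    disjoint (_ , _ , refl) (_ , _ , ())

  sublist-⊆ : ∀ {A : Set} {ys} (xs : List A) → ys ∈ sublists xs →
              ∀ {z} → z ∈ ys → z ∈ xs
  sublist-⊆ [] (here refl) ()
  sublist-⊆ (x ∷ xs) p z∈ with ∈-++⁻ (sublists xs) p
  ... | inj₁ q = there (sublist-⊆ xs q z∈)
  ... | inj₂ q with ∈-map⁻ (x ∷_) q
  sublist-⊆ (x ∷ xs) p (here e)   | inj₂ q | _ , _ , refl = here e
  sublist-⊆ (x ∷ xs) p (there z∈) | inj₂ q | _ , r , refl = there (sublist-⊆ xs r z∈)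

  sublist-unique : ∀ {A : Set} {ys} (xs : List A) → Unique xs →
                   ys ∈ sublists xs → Unique ys
  sublist-unique [] u (here refl) = []
  sublist-unique (x ∷ xs) (x∉ ∷ u) p with ∈-++⁻ (sublists xs) p
  ... | inj₁ q = sublist-unique xs u q
  ... | inj₂ q with ∈-map⁻ (x ∷_) q
  ... | _ , r , refl =
    All.tabulate (λ z∈ → All.lookup x∉ (sublist-⊆ xs r z∈)) ∷ sublist-unique xs u r

  filter∈sublists : ∀ {A : Set} {P : A → Set} (P? : ∀ x → Dec (P x)) xs →
                    filter P? xs ∈ sublists xs
  filter∈sublists P? [] = here refl
  filter∈sublists P? (x ∷ xs) with P? x
  ... | yes _ = ∈-++⁺ʳ (sublists xs) (∈-map⁺ (x ∷_) (filter∈sublists P? xs))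
  ... | no  _ = ∈-++⁺ˡ (filter∈sublists P? xs)

  length-mono : ∀ {A : Set} {xs ys : List A} → Unique xs →
                (∀ {z} → z ∈ xs → z ∈ ys) → length xs ≤ length ys
  length-mono [] _ = z≤n
  length-mono {xs = x ∷ xs} (x∉ ∷ u) sub with ∈-∃++ (sub (here refl))
  ... | as , bs , refl = ≤-trans
    (s≤s (length-mono u sub′))
    (≤-reflexive (trans (cong suc (length-++ as))
      (trans (sym (+-suc (length as) (length bs))) (sym (length-++ as)))))
    where
    sub′ : ∀ {z} → z ∈ xs → z ∈ as ++ bs
    sub′ z∈ with ∈-++⁻ as (sub (there z∈))
    ... | inj₁ q         = ∈-++⁺ˡ q
    ... | inj₂ (here e)  = contradiction (sym e) (All.lookup x∉ z∈)
    ... | inj₂ (there q) = ∈-++⁺ʳ as q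

g-isMaximum : ∀ n k ℓ → IsMaximum (AttainedSize n k ℓ) (g n k ℓ)
g-isMaximum n k ℓ = attained , upper
  where
  sizes : List ℕ
  sizes = map length (filter (H? ℓ) (sublists (kSubsets n k)))

  attained : AttainedSize n k ℓ (g n k ℓ)
  attained with argmax-sel id 0 sizes
  ... | inj₁ g≡0 = [] , [] , [] , (λ ()) , sym g≡0
  ... | inj₂ g∈ with ∈-map⁻ length g∈
  ... | F , F∈ , g≡ with ∈-filter⁻ (H? ℓ) {xs = sublists (kSubsets n k)} F∈
  ... | F∈′ , hF =
    F ,
    sublist-unique _ (Unique.filter⁺ _ (subsets-unique n)) F∈′ ,
    All.tabulate (λ A∈ → proj₂ (∈-filter⁻ (λ A → ∣ A ∣ ≟ k) {xs = subsets n} (sublist-⊆ _ F∈′ A∈))) ,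
    hF , sym g≡

  upper : ∀ {x} → AttainedSize n k ℓ x → x ≤ g n k ℓ
  upper (F , uF , kF , hF , refl) = ≤-trans
    (length-mono uF λ A∈ →
      ∈-filter⁺ ∈F? (∈-filter⁺ (λ A → ∣ A ∣ ≟ k) (∈-subsets _) (All.lookup kF A∈)) A∈)
    (All.lookup (xs≤max 0 sizes)
      (∈-map⁺ length (∈-filter⁺ (H? ℓ) (filter∈sublists ∈F? (kSubsets n k))
        λ A∈ B∈ C∈ → hF (back A∈) (back B∈) (back C∈))))
    where
    ∈F? : ∀ A → Dec (A ∈ F)
    ∈F? A = any? (A ≟ˢ_) F

    back : ∀ {A} → A ∈ filter ∈F? (kSubsets n k) → A ∈ F
    back = proj₂ ∘ ∈-filter⁻ ∈F? {xs = kSubsets n k}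

{-# OPTIONS --safe #-}

-- For m = f(j,ℓ), take all k-sets meeting the first m points in at least j
-- points.  A point lying in c of the three sets A, B, C contributes
-- c(c−1)/2 to d(A,B,C), and for c ∈ {0,1,2,3} this is at least c − 1 and at
-- least 2c − 3.  Summing over the first m points gives d ≥ 3j − m and
-- d ≥ 6j − 3m, and the two cases of f make one of these bounds at least ℓ.
module Submission where

open import Defs
open import Data.Bool.Base using (true; false; _∧_)
open import Data.Empty using (⊥)
open import Data.Fin.Subset using (Subset; inside; outside; _∩_; ∣_∣)
open import Data.Integer.Base using (+_; -[1+_]; _⊖_; _-_)
import Data.Integer.Properties as ℤ
open import Data.List.Base using (List; []; _∷_; _++_; map; filter; length; upTo; concatMap; cartesianProductWith)
open import Data.List.Extrema.Nat using (max≤v⁺)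
open import Data.List.Membership.Propositional using (_∈_; find)
open import Data.List.Membership.Propositional.Properties
open import Data.List.Properties using (length-++; length-map; map-cong)
open import Data.List.Relation.Unary.All as All using ([])
import Data.List.Relation.Unary.All.Properties as All
open import Data.List.Relation.Unary.AllPairs using ([]; _∷_)
open import Data.List.Relation.Unary.Any using (here)
open import Data.List.Relation.Unary.Unique.Propositional using (Unique)
import Data.List.Relation.Unary.Unique.Propositional.Properties as Unique
open import Data.Nat.Base using (ℕ; zero; suc; _+_; _*_; _∸_; _≤_; _<_; z≤n; s≤s; s≤s⁻¹)
open import Data.Nat.Combinatorics using (nCk+nC[k+1]≡[n+1]C[k+1]) renaming (_C_ to _choose_)
open import Data.Nat.DivMod using (_%_; m≡m%n+[m/n]*n; m%n<n)
open import Data.Nat.ListAction using (sum)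
open import Data.Nat.Properties
open import Data.Nat.Tactic.RingSolver using (solve-∀)
open import Data.Product.Base using (_×_; _,_; ∃; ∃₂; proj₁; proj₂)
open import Data.Sum.Base using (inj₁; inj₂)
open import Data.Vec.Base as Vec using ([]; _∷_)
open import Data.Vec.Properties using (∷-injectiveʳ; ++-injective)
open import Relation.Binary.PropositionalEquality using (_≡_; refl; sym; trans; cong; cong₂; subst; module ≡-Reasoning)
open import Relation.Nullary.Decidable using (yes; no; True; toWitness)

private
  variable
    m n r : ℕ
    X Y Z : Set

-- Counting the pairwise intersections

-- The cardinality `∣ x ∷ [] ∣` serves as the 0/1 value of the bit `x`, so that counts split one
-- point at a time.
∣∷∣ : ∀ x (A : Subset n) → ∣ x ∷ A ∣ ≡ ∣ x ∷ [] ∣ + ∣ A ∣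
∣∷∣ outside A = refl
∣∷∣ inside  A = refl

∣++∣ : (A : Subset m) (B : Subset n) → ∣ A Vec.++ B ∣ ≡ ∣ A ∣ + ∣ B ∣
∣++∣ []            B = refl
∣++∣ (outside ∷ A) B = ∣++∣ A B
∣++∣ (inside ∷ A)  B = cong suc (∣++∣ A B)

∣∩∣-≤-++ : (A B : Subset m) {A′ B′ : Subset r} →
           ∣ A ∩ B ∣ ≤ ∣ (A Vec.++ A′) ∩ (B Vec.++ B′) ∣
∣∩∣-≤-++ []            []            = z≤n
∣∩∣-≤-++ (outside ∷ A) (y ∷ B)       = ∣∩∣-≤-++ A B
∣∩∣-≤-++ (inside ∷ A)  (outside ∷ B) = ∣∩∣-≤-++ A B
∣∩∣-≤-++ (inside ∷ A)  (inside ∷ B)  = s≤s (∣∩∣-≤-++ A B)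

-- Tails can only add common points, so lower bounds on `d` need only be proved for the heads.
d-≤-++ : (A B C : Subset m) {A′ B′ C′ : Subset r} →
         d A B C ≤ d (A Vec.++ A′) (B Vec.++ B′) (C Vec.++ C′)
d-≤-++ A B C =
  +-mono-≤ (+-mono-≤ (∣∩∣-≤-++ A B) (∣∩∣-≤-++ B C)) (∣∩∣-≤-++ C A)

+³-interchange : ∀ a a′ b b′ c c′ →
                 (a + a′) + (b + b′) + (c + c′) ≡ (a + b + c) + (a′ + b′ + c′)
+³-interchange = solve-∀

∣∣³-∷ : ∀ x y z (A B C : Subset n) →
        ∣ x ∷ A ∣ + ∣ y ∷ B ∣ + ∣ z ∷ C ∣ ≡
        (∣ x ∷ [] ∣ + ∣ y ∷ [] ∣ + ∣ z ∷ [] ∣) + (∣ A ∣ + ∣ B ∣ + ∣ C ∣)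
∣∣³-∷ x y z A B C = trans
  (cong₂ _+_ (cong₂ _+_ (∣∷∣ x A) (∣∷∣ y B)) (∣∷∣ z C))
  (+³-interchange (∣ x ∷ [] ∣) (∣ A ∣) (∣ y ∷ [] ∣) (∣ B ∣) (∣ z ∷ [] ∣) (∣ C ∣))

-- A linear bound on d need only be checked on a one-point ground set.
d-pointwise-bound : ∀ α β →
  (∀ x y z → α * (∣ x ∷ [] ∣ + ∣ y ∷ [] ∣ + ∣ z ∷ [] ∣) ≤ d (x ∷ []) (y ∷ []) (z ∷ []) + β) →
  (A B C : Subset n) → α * (∣ A ∣ + ∣ B ∣ + ∣ C ∣) ≤ d A B C + n * β
d-pointwise-bound α β point [] [] [] = ≤-reflexive (*-zeroʳ α)
d-pointwise-bound {suc n} α β point (x ∷ A) (y ∷ B) (z ∷ C) = begin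
  α * (∣ x ∷ A ∣ + ∣ y ∷ B ∣ + ∣ z ∷ C ∣)
    ≡⟨ cong (α *_) (∣∣³-∷ x y z A B C) ⟩
  α * ((∣ x ∷ [] ∣ + ∣ y ∷ [] ∣ + ∣ z ∷ [] ∣) + (∣ A ∣ + ∣ B ∣ + ∣ C ∣))
    ≡⟨ *-distribˡ-+ α (∣ x ∷ [] ∣ + ∣ y ∷ [] ∣ + ∣ z ∷ [] ∣) _ ⟩
  α * (∣ x ∷ [] ∣ + ∣ y ∷ [] ∣ + ∣ z ∷ [] ∣) + α * (∣ A ∣ + ∣ B ∣ + ∣ C ∣)
    ≤⟨ +-mono-≤ (point x y z) (d-pointwise-bound α β point A B C) ⟩
  (d (x ∷ []) (y ∷ []) (z ∷ []) + β) + (d A B C + n * β)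
    ≡⟨ swap (d (x ∷ []) (y ∷ []) (z ∷ [])) β (d A B C) (n * β) ⟩
  (d (x ∷ []) (y ∷ []) (z ∷ []) + d A B C) + (β + n * β)
    ≡⟨ cong (_+ (β + n * β)) (∣∣³-∷ (x ∧ y) (y ∧ z) (z ∧ x) (A ∩ B) (B ∩ C) (C ∩ A)) ⟨
  d (x ∷ A) (y ∷ B) (z ∷ C) + suc n * β ∎
  where
  open ≤-Reasoning
  swap : ∀ a b c e → (a + b) + (c + e) ≡ (a + c) + (b + e)
  swap = solve-∀

-- For closed numerals the `True` argument reduces to the unit type and is filled in automatically.
≤-by-computation : ∀ {a b} {_ : True (a ≤? b)} → a ≤ b
≤-by-computation {_} {_} {p} = toWitness p

-- At a point lying in c of the sets this is c ≤ c(c-1)/2 + 1, with equality for c = 1 and c = 2.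
∣∣³≤d+n : (A B C : Subset n) → 1 * (∣ A ∣ + ∣ B ∣ + ∣ C ∣) ≤ d A B C + n * 1
∣∣³≤d+n = d-pointwise-bound 1 1 λ where
  false false false → ≤-by-computation
  false false true  → ≤-by-computation
  false true  false → ≤-by-computation
  false true  true  → ≤-by-computation
  true  false false → ≤-by-computation
  true  false true  → ≤-by-computation
  true  true  false → ≤-by-computation
  true  true  true  → ≤-by-computation

-- At a point lying in c of the sets this is 2c ≤ c(c-1)/2 + 3, with equality for c = 2 and c = 3.
2∣∣³≤d+3n : (A B C : Subset n) → 2 * (∣ A ∣ + ∣ B ∣ + ∣ C ∣) ≤ d A B C + n * 3
2∣∣³≤d+3n = d-pointwise-bound 2 3 λ where
  false false false → ≤-by-computation
  false false true  → ≤-by-computation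
  false true  false → ≤-by-computation
  false true  true  → ≤-by-computation
  true  false false → ≤-by-computation
  true  false true  → ≤-by-computation
  true  true  false → ≤-by-computation
  true  true  true  → ≤-by-computation

-- All that the construction needs to know about m = f(j,ℓ); the case distinction in `f` stays
-- hidden behind it.
LargeIntersections : ℕ → ℕ → ℕ → Set
LargeIntersections m j ℓ =
  (A B C : Subset m) → j ≤ ∣ A ∣ → j ≤ ∣ B ∣ → j ≤ ∣ C ∣ → ℓ ≤ d A B C

m+ℓ≡3j⇒large : ∀ {j ℓ} → m + ℓ ≡ 3 * j → LargeIntersections m j ℓ
m+ℓ≡3j⇒large {m} {j} {ℓ} eq A B C a b c = +-cancelʳ-≤ (m * 1) ℓ (d A B C) (begin
  ℓ + m * 1                      ≡⟨ lemma ℓ m ⟩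
  m + ℓ                          ≡⟨ eq ⟩
  3 * j                          ≡⟨ lemma₂ j ⟩
  1 * (j + j + j)                ≤⟨ *-monoʳ-≤ 1 (+-mono-≤ (+-mono-≤ a b) c) ⟩
  1 * (∣ A ∣ + ∣ B ∣ + ∣ C ∣)    ≤⟨ ∣∣³≤d+n A B C ⟩
  d A B C + m * 1                ∎)
  where
  open ≤-Reasoning
  lemma : ∀ ℓ m → ℓ + m * 1 ≡ m + ℓ
  lemma = solve-∀
  lemma₂ : ∀ j → 3 * j ≡ 1 * (j + j + j)
  lemma₂ = solve-∀

-- Here `q` stands for ⌈ℓ/3⌉, of which only 3q ≥ ℓ matters: 6j ≤ d + 3m and 6j = 3m + 3q give d ≥
-- 3q.
m+q≡2j⇒large : ∀ {q j ℓ} → ℓ ≤ q * 3 → m + q ≡ 2 * j → LargeIntersections m j ℓ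
m+q≡2j⇒large {m} {q} {j} {ℓ} ℓ≤3q eq A B C a b c =
  +-cancelʳ-≤ (m * 3) ℓ (d A B C) (begin
  ℓ + m * 3                      ≤⟨ +-monoˡ-≤ (m * 3) ℓ≤3q ⟩
  q * 3 + m * 3                  ≡⟨ lemma q m ⟩
  3 * (m + q)                    ≡⟨ cong (3 *_) eq ⟩
  3 * (2 * j)                    ≡⟨ lemma₂ j ⟩
  2 * (j + j + j)                ≤⟨ *-monoʳ-≤ 2 (+-mono-≤ (+-mono-≤ a b) c) ⟩
  2 * (∣ A ∣ + ∣ B ∣ + ∣ C ∣)    ≤⟨ 2∣∣³≤d+3n A B C ⟩
  d A B C + m * 3                ∎)
  where
  open ≤-Reasoning
  lemma : ∀ q m → q * 3 + m * 3 ≡ 3 * (m + q)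
  lemma = solve-∀
  lemma₂ : ∀ j → 3 * (2 * j) ≡ 2 * (j + j + j)
  lemma₂ = solve-∀

-- The two cases of `f`

m≤⌈m/3⌉*3 : ∀ m → m ≤ ⌈ m /3⌉ * 3
m≤⌈m/3⌉*3 m = +-cancelˡ-≤ 2 m (⌈ m /3⌉ * 3) (begin
  2 + m                        ≡⟨ +-comm 2 m ⟩
  m + 2                        ≡⟨ m≡m%n+[m/n]*n (m + 2) 3 ⟩
  -- A remainder modulo 3 is at most 2, which is exactly what the rounding up added.
  (m + 2) % 3 + ⌈ m /3⌉ * 3    ≤⟨ +-monoˡ-≤ (⌈ m /3⌉ * 3) (s≤s⁻¹ (m%n<n (m + 2) 3)) ⟩
  2 + ⌈ m /3⌉ * 3              ∎)
  where open ≤-Reasoning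

⊖≡+⇒ : ∀ a b {c} → a ⊖ b ≡ + c → c + b ≡ a
⊖≡+⇒ a       zero    {c} refl = +-identityʳ c
⊖≡+⇒ (suc a) (suc b) {c} eq   = trans (+-suc c b)
  (cong suc (⊖≡+⇒ a b (trans (sym (ℤ.[1+m]⊖[1+n]≡m⊖n a b)) eq)))

-- Repeating the test of `f` makes `eq` reduce. Small j uses the bound 6j - 3m, large j the bound 3j
-- - m.
f-large : ∀ j ℓ → f j ℓ ≡ + m → LargeIntersections m j ℓ
f-large j ℓ eq with 3 * j <? 2 * ℓ
... | yes _ = m+q≡2j⇒large (m≤⌈m/3⌉*3 ℓ) (⊖≡+⇒ (2 * j) ⌈ ℓ /3⌉ eq)
... | no  _ = m+ℓ≡3j⇒large (⊖≡+⇒ (3 * j) ℓ eq)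

-- Lists without repetitions

length-cartesianProductWith : (h : X → Y → Z) (xs : List X) (ys : List Y) →
  length (cartesianProductWith h xs ys) ≡ length xs * length ys
length-cartesianProductWith h []       ys = refl
length-cartesianProductWith h (x ∷ xs) ys = trans (length-++ (map (h x) ys))
  (cong₂ _+_ (length-map (h x) ys) (length-cartesianProductWith h xs ys))

length-concatMap : (h : X → List Y) (xs : List X) →
  length (concatMap h xs) ≡ sum (map (λ x → length (h x)) xs)
length-concatMap h []       = refl
length-concatMap h (x ∷ xs) =
  trans (length-++ (h x)) (cong (_+_ (length (h x))) (length-concatMap h xs))

unique-concatMap : (h : X → List Y) → (∀ x → Unique (h x)) →
  (∀ {x x′ y} → y ∈ h x → y ∈ h x′ → x ≡ x′) →
  ∀ {xs} → Unique xs → Unique (concatMap h xs)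
unique-concatMap h unique disjoint []                  = []
unique-concatMap h unique disjoint {x ∷ xs} (x∉xs ∷ u) = Unique.++⁺
  (unique x) (unique-concatMap h unique disjoint u)
  -- A shared element would make `x` equal to an entry of `xs`, against `x∉xs`.
  λ (y∈hx , y∈rest) →
    let x′ , x′∈xs , y∈hx′ = find (∈-concatMap⁻ h {xs = xs} y∈rest)
    in All.lookup x∉xs x′∈xs (disjoint y∈hx y∈hx′)

-- The extremal family

-- The recursion copies Pascal's rule, so the binomial count follows by induction.
layer : ∀ n → ℕ → Family n
layer zero    zero    = [] ∷ []
layer zero    (suc i) = []
layer (suc n) zero    = map (outside ∷_) (layer n zero)
layer (suc n) (suc i) = map (inside ∷_) (layer n i) ++ map (outside ∷_) (layer n (suc i))

length-layer : ∀ n i → length (layer n i) ≡ n choose i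
length-layer zero    zero    = refl
length-layer zero    (suc i) = refl
length-layer (suc n) zero    =
  trans (length-map (outside ∷_) (layer n zero)) (length-layer n zero)
length-layer (suc n) (suc i) = begin
  length (layer (suc n) (suc i))
    ≡⟨ length-++ (map (inside ∷_) (layer n i)) ⟩
  length (map (inside ∷_) (layer n i)) + length (map (outside ∷_) (layer n (suc i)))
    ≡⟨ cong₂ _+_ (length-map (inside ∷_) (layer n i)) (length-map (outside ∷_) (layer n (suc i))) ⟩
  length (layer n i) + length (layer n (suc i))
    ≡⟨ cong₂ _+_ (length-layer n i) (length-layer n (suc i)) ⟩
  n choose i + n choose suc i
    ≡⟨ nCk+nC[k+1]≡[n+1]C[k+1] n i ⟩
  suc n choose suc i ∎
  where open ≡-Reasoning

∈-layer⇒∣∣≡ : ∀ n i {A} → A ∈ layer n i → ∣ A ∣ ≡ i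
∈-layer⇒∣∣≡ zero    zero    (here refl) = refl
∈-layer⇒∣∣≡ (suc n) zero    A∈ with ∈-map⁻ (outside ∷_) A∈
... | _ , A′∈ , refl = ∈-layer⇒∣∣≡ n zero A′∈
∈-layer⇒∣∣≡ (suc n) (suc i) A∈ with ∈-++⁻ (map (inside ∷_) (layer n i)) A∈
... | inj₁ p with ∈-map⁻ (inside ∷_) p
...   | _ , A′∈ , refl = cong suc (∈-layer⇒∣∣≡ n i A′∈)
∈-layer⇒∣∣≡ (suc n) (suc i) A∈ | inj₂ p with ∈-map⁻ (outside ∷_) p
...   | _ , A′∈ , refl = ∈-layer⇒∣∣≡ n (suc i) A′∈

layer-unique : ∀ n i → Unique (layer n i)
layer-unique zero    zero    = [] ∷ []
layer-unique zero    (suc i) = []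
layer-unique (suc n) zero    = Unique.map⁺ ∷-injectiveʳ (layer-unique n zero)
layer-unique (suc n) (suc i) = Unique.++⁺
  (Unique.map⁺ ∷-injectiveʳ (layer-unique n i))
  (Unique.map⁺ ∷-injectiveʳ (layer-unique n (suc i)))
  λ (p , q) → case-heads (∈-map⁻ (inside ∷_) p) (∈-map⁻ (outside ∷_) q)
  where
  case-heads : ∀ {v : Subset (suc n)} {P Q : Subset n → Set} →
               ∃ (λ A → P A × v ≡ inside ∷ A) → ∃ (λ A → Q A × v ≡ outside ∷ A) → ⊥
  case-heads (_ , _ , refl) (_ , _ , ())

module _ (m r k : ℕ) where

  -- Writing n as `m + r` makes each set a head on the first m points followed by a tail. One block
  -- realises one summand of the lower bound.
  block : ℕ → Family (m + r)
  block i = cartesianProductWith Vec._++_ (layer m i) (layer r (k ∸ i))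

  ∈-block : ∀ i {A} → A ∈ block i →
            ∃₂ λ A₁ A₂ → ∣ A₁ ∣ ≡ i × ∣ A₂ ∣ ≡ k ∸ i × A ≡ A₁ Vec.++ A₂
  ∈-block i A∈ with ∈-cartesianProductWith⁻ Vec._++_ (layer m i) (layer r (k ∸ i)) A∈
  ... | A₁ , A₂ , A₁∈ , A₂∈ , eq =
    A₁ , A₂ , ∈-layer⇒∣∣≡ m i A₁∈ , ∈-layer⇒∣∣≡ r (k ∸ i) A₂∈ , eq

  block-unique : ∀ i → Unique (block i)
  block-unique i = Unique.cartesianProductWith⁺ Vec._++_ (++-injective _ _)
    (layer-unique m i) (layer-unique r (k ∸ i))

  -- A set determines its block: the index is the size of its head.
  blocks-disjoint : ∀ {i i′ A} → A ∈ block i → A ∈ block i′ → i ≡ i′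
  blocks-disjoint {i} {i′} p q with ∈-block i p | ∈-block i′ q
  ... | A₁ , A₂ , refl , _ , refl | B₁ , B₂ , refl , _ , eq =
    cong ∣_∣ (proj₁ (++-injective A₁ B₁ eq))

  length-block : ∀ i → length (block i) ≡ (m choose i) * (r choose (k ∸ i))
  length-block i = trans
    (length-cartesianProductWith Vec._++_ (layer m i) (layer r (k ∸ i)))
    (cong₂ _*_ (length-layer m i) (length-layer r (k ∸ i)))

  module _ (j : ℕ) where

    indices : List ℕ
    indices = filter (j ≤?_) (upTo (suc k))

    family : Family (m + r)
    family = concatMap block indices

    family-unique : Unique family
    family-unique = unique-concatMap block block-unique blocks-disjoint
      (Unique.filter⁺ (j ≤?_) (Unique.upTo⁺ (suc k)))

    ∈-family : ∀ {A} → A ∈ family →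
               ∃₂ λ A₁ A₂ → j ≤ ∣ A₁ ∣ × ∣ A ∣ ≡ k × A ≡ A₁ Vec.++ A₂
    ∈-family A∈ with find (∈-concatMap⁻ block {xs = indices} A∈)
    ... | i , i∈ , A∈block with ∈-filter⁻ (j ≤?_) {xs = upTo (suc k)} i∈ | ∈-block i A∈block
    ... | i∈upTo , j≤i | A₁ , A₂ , refl , ∣A₂∣ , refl =
      A₁ , A₂ , j≤i ,
      -- Indices come from `upTo (suc k)`, so i ≤ k and `k ∸ i` is not truncated.
      trans (∣++∣ A₁ A₂) (trans (cong (_+_ ∣ A₁ ∣) ∣A₂∣)
        (m+[n∸m]≡n (s≤s⁻¹ (∈-upTo⁻ i∈upTo)))) ,
      refl

    family-H : ∀ {ℓ} → LargeIntersections m j ℓ → H ℓ family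
    family-H large A∈ B∈ C∈ with ∈-family A∈ | ∈-family B∈ | ∈-family C∈
    ... | A , _ , a , _ , refl | B , _ , b , _ , refl | C , _ , c , _ , refl =
      ≤-trans (large A B C a b c) (d-≤-++ A B C)

    length-family : length family ≡ ∑[ j ⋯ k ] (λ i → (m choose i) * (r choose (k ∸ i)))
    length-family = trans (length-concatMap block indices)
      (cong sum (map-cong length-block indices))

    ∑-≤-g : ∀ {ℓ} → LargeIntersections m j ℓ →
            ∑[ j ⋯ k ] (λ i → (m choose i) * (r choose (k ∸ i))) ≤ g (m + r) k ℓ
    ∑-≤-g {ℓ} large = proj₂ (g-isMaximum (m + r) k ℓ)
      ( family , family-unique
      , All.tabulate (λ A∈ → let _ , _ , _ , ∣A∣≡k , _ = ∈-family A∈ in ∣A∣≡k)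
      , family-H large , length-family )

-- Integer arguments of the binomials

sum-map-zero : (h : X → ℕ) → (∀ x → h x ≡ 0) → ∀ xs → sum (map h xs) ≡ 0
sum-map-zero h h≡0 []       = refl
sum-map-zero h h≡0 (x ∷ xs) = cong₂ _+_ (h≡0 x) (sum-map-zero h h≡0 xs)

-- If `u` or `v` is negative, the convention kills a factor of every term and the sum is 0.
-- Otherwise both are naturals with sum n, and the family applies. Keeping `v` a variable tied by an
-- equation allows matching on its sign.
∑-binom-≤-g : ∀ n k ℓ j u v → v ≡ + n - u → (∀ {m} → u ≡ + m → LargeIntersections m j ℓ) →
              ∑[ j ⋯ k ] (λ i → binom u i * binom v (k ∸ i)) ≤ g n k ℓ
∑-binom-≤-g n k ℓ j -[1+ _ ] v _ large =
  subst (_≤ g n k ℓ) (sym (sum-map-zero _ (λ _ → refl) (filter (j ≤?_) (upTo (suc k))))) z≤n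
∑-binom-≤-g n k ℓ j (+ m) -[1+ _ ] _ large =
  subst (_≤ g n k ℓ) (sym (sum-map-zero _ (λ i → *-zeroʳ (m choose i)) (filter (j ≤?_) (upTo (suc k))))) z≤n
∑-binom-≤-g n k ℓ j (+ m) (+ r) eq large =
  -- The family lives on `m + r` points; this transports its bound to n.
  subst (λ n → _ ≤ g n k ℓ) (trans (+-comm m r) r+m≡n) (∑-≤-g m r k j (large refl))
  where
  r+m≡n : r + m ≡ n
  r+m≡n = ⊖≡+⇒ n m (trans (sym (ℤ.m-n≡m⊖n n m)) (sym eq))

theorem2p3 : (k ℓ n : ℕ) → 0 < k → 0 < ℓ → 0 < n → ℓ ≤ 3 * k → maxLowerSum n k ℓ ≤ g n k ℓ
-- `z≤n` handles the default value 0 of `max`; what remains is a bound for each j separately.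
theorem2p3 k ℓ n _ _ _ _ = max≤v⁺ z≤n
  (All.map⁺ (All.universal
    (λ j → ∑-binom-≤-g n k ℓ j (f j ℓ) (+ n - f j ℓ) refl (f-large j ℓ)) (range k ℓ)))
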